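{- For any $\epsilon\in(0,0.9)$, any $O(1)$-pass $(1+\epsilon,0.49)$-$L_{\mathrm{DI}}$-sampler (in the node-arrival streaming model) on a data stream of length $n$ needs $\Omega(\sqrt{n})$ bits of space.
   Context: Similarity graph. $U$ is a universe of items and $f:U\times U\to[0,1]$ is a symmetric similarity function with $f(x,x)=1$ for all $x\in U$. For a stream $\sigma=(\sigma_1,\dots,\sigma_n)\in U^n$, the degree of node $i\in[n]$ in the similarity graph $G^\sigma$ (complete graph on $[n]$ with self-loops, weights $w(i,j)=f(\sigma_i,\sigma_j)$) is $d_i=\sum_{j\in[n]} f(\sigma_i,\sigma_j)$, and $\mathrm{DI}(\sigma)=\sum_{i\in[n]} d_i^{ -1}$. Each stream position is a distinct node; node $i$ is represented by the pair $(i,\sigma_i)$. Sampler. A $(1+\epsilon,\delta)$-$L_{\mathrm{DI}}$-sampler on $G^\sigma$ fails with probability at most $\delta$ and, conditioned on no failure, outputs node $i$ with a probability $p_i$ satisfying $(1-\epsilon)\frac{d_i^{ -1}}{\mathrm{DI}(\sigma)}\le p_i\le(1+\epsilon)\frac{d_i^{ -1}}{\mathrm{DI}(\sigma)}$, for every $i\in[n]$. Node-arrival streaming model. The items $\sigma_1,\dots,\sigma_n$ arrive sequentially and the algorithm, which has access to $f$, makes one or more linear scans (passes) over them while maintaining a bounded memory state. Algorithms are randomized; the algorithm's guarantee is required for every universe $U$, every similarity function $f$ and every stream $\sigma$ of length $n$, and its space is the worst-case number of bits of memory. The constant hidden in $\Omega(\cdot)$ may depend on the constant number of passes. -}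

module Defs where

open import Level using (Level; _⊔_) renaming (suc to lsuc)
open import Algebra.Bundles using (CommutativeRing)
import Algebra.Properties.CommutativeMonoid.Sum as Sum
import Algebra.Definitions.RawMonoid as RawMonoidDefs
open import Data.Bool.Base using (Bool; if_then_else_)
open import Data.Fin.Base using (Fin)
import Data.Fin.Properties as Fin
open import Data.List.Base using (foldl; allFin)
open import Data.Maybe.Base using (Maybe; just; nothing)
import Data.Maybe.Properties as Maybe
open import Data.Nat.Base using (ℕ)
open import Data.Product.Base using (_×_)
open import Data.Vec.Base using (Vec)
open import Data.Vec.Functional using (Vector)
open import Relation.Binary.Core using (Rel)
open import Relation.Binary.PropositionalEquality.Core using (_≡_)
open import Relation.Binary.Structures using (IsTotalOrder)
open import Relation.Nullary.Decidable.Core using (does)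
open import Relation.Nullary.Negation.Core using (¬_)
open import Relation.Unary using (Pred; Decidable)
open import Relation.Unary.Properties using (_∩?_; ∁?)

-- Stands in for ℝ, which is an instance (classically). Results are stated for
-- every ordered field, so nothing is restricted to rational similarities,
-- probabilities or error parameters. The inverse is total, with an unspecified
-- value at 0#.
record OrderedField (c ℓ₁ ℓ₂ : Level) : Set (lsuc (c ⊔ ℓ₁ ⊔ ℓ₂)) where
  infix 8 _⁻¹
  infix 4 _≤_ _<_
  field
    commutativeRing : CommutativeRing c ℓ₁
  open CommutativeRing commutativeRing public
  field
    _≤_          : Rel Carrier ℓ₂
    _⁻¹          : Carrier → Carrier
    isTotalOrder : IsTotalOrder _≈_ _≤_
    +-monoʳ-≤    : ∀ x {y z} → y ≤ z → x + y ≤ x + z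
    *-nonNeg     : ∀ {x y} → 0# ≤ x → 0# ≤ y → 0# ≤ x * y
    0≉1          : ¬ 0# ≈ 1#
    ⁻¹-cong      : ∀ {x y} → x ≈ y → x ⁻¹ ≈ y ⁻¹
    ⁻¹-inverseʳ  : ∀ {x} → ¬ x ≈ 0# → x * x ⁻¹ ≈ 1#

  _<_ : Rel Carrier (ℓ₁ ⊔ ℓ₂)
  x < y = x ≤ y × ¬ x ≈ y

  open Sum +-commutativeMonoid public using (sum)

  fromℕ : ℕ → Carrier
  fromℕ k = k · 1#
    where open RawMonoidDefs +-rawMonoid renaming (_×_ to _·_)

  infixl 7 _/ℕ_
  _/ℕ_ : ℕ → ℕ → Carrier
  a /ℕ b = fromℕ a * fromℕ b ⁻¹

module _ {c ℓ₁ ℓ₂ : Level} (K : OrderedField c ℓ₁ ℓ₂) where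
  open OrderedField K

  record Similarity (U : Set) : Set (c ⊔ ℓ₁ ⊔ ℓ₂) where
    field
      f       : U → U → Carrier
      f-lower : ∀ x y → 0# ≤ f x y
      f-upper : ∀ x y → f x y ≤ 1#
      f-sym   : ∀ x y → f x y ≈ f y x
      f-refl  : ∀ x → f x x ≈ 1#

  module SimilarityGraph {U : Set} (F : Similarity U) {n : ℕ} (σ : Vector U n) where
    open Similarity F

    weight : Fin n → Fin n → Carrier
    weight i j = f (σ i) (σ j)

    degree : Fin n → Carrier
    degree i = sum (λ j → weight i j)

    DI : Carrier
    DI = sum (λ i → degree i ⁻¹)

  record Distribution (r : ℕ) : Set (c ⊔ ℓ₁ ⊔ ℓ₂) where
    field
      mass        : Fin r → Carrier
      mass-nonNeg : ∀ ω → 0# ≤ mass ω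
      mass-total  : sum mass ≈ 1#

    Pr : ∀ {ℓ} {E : Pred (Fin r) ℓ} → Decidable E → Carrier
    Pr E? = sum (λ ω → if does (E? ω) then mass ω else 0#)

    Pr[_∣_] : ∀ {ℓ ℓ′} {E : Pred (Fin r) ℓ} {G : Pred (Fin r) ℓ′} →
              Decidable E → Decidable G → Carrier
    Pr[ E? ∣ G? ] = Pr (E? ∩? G?) * Pr G? ⁻¹

  -- A randomized p-pass algorithm with s bits of memory on streams of length n
  -- over U, as a distribution over deterministic ones. Only what is carried
  -- from one stream item to the next is charged: the random seed, the pass
  -- number and the position may be consulted for free, and computation between
  -- items is unrestricted. The output `nothing` is failure.
  record Algorithm (U : Set) (n p s : ℕ) : Set (c ⊔ ℓ₁ ⊔ ℓ₂) where
    field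
      seeds    : ℕ
      seedDist : Distribution seeds
      start    : Fin seeds → Vec Bool s
      step     : Fin seeds → Fin p → Fin n → U → Vec Bool s → Vec Bool s
      output   : Fin seeds → Vec Bool s → Maybe (Fin n)

    runPass : Fin seeds → Vector U n → Vec Bool s → Fin p → Vec Bool s
    runPass ω σ memory k = foldl (λ m i → step ω k i (σ i) m) memory (allFin n)

    run : Fin seeds → Vector U n → Maybe (Fin n)
    run ω σ = output ω (foldl (runPass ω σ) (start ω) (allFin p))

    open Distribution seedDist

    outputs? : (σ : Vector U n) (o : Maybe (Fin n)) → Decidable (λ ω → run ω σ ≡ o)
    outputs? σ o ω = Maybe.≡-dec Fin._≟_ (run ω σ) o

    failure : Vector U n → Carrier
    failure σ = Pr (outputs? σ nothing)

    outputProb : Vector U n → Fin n → Carrier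
    outputProb σ i = Pr[ outputs? σ (just i) ∣ ∁? (outputs? σ nothing) ]

  record IsSamplerOn {U : Set} (F : Similarity U) {n p s : ℕ}
                     (ε δ : Carrier) (A : Algorithm U n p s) : Set (c ⊔ ℓ₁ ⊔ ℓ₂) where
    open Algorithm A
    open SimilarityGraph F
    field
      failure-bound : ∀ σ → failure σ ≤ δ
      lower-bound   : ∀ σ i →
        (1# - ε) * (degree σ i ⁻¹ * DI σ ⁻¹) ≤ outputProb σ i
      upper-bound   : ∀ σ i →
        outputProb σ i ≤ (1# + ε) * (degree σ i ⁻¹ * DI σ ⁻¹)

  -- A (1+ε,δ)-sampler must work for every (finite) universe, here Fin m, and
  -- every similarity function on it. The algorithm has full access to the
  -- similarity function, so it may depend on it arbitrarily; so may the number
  -- of bits it uses. For a given similarity function that number is the worst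
  -- case over streams and seeds.
  record Sampler (n p : ℕ) (ε δ : Carrier) : Set (c ⊔ ℓ₁ ⊔ ℓ₂) where
    field
      space     : ∀ {m} → Similarity (Fin m) → ℕ
      algorithm : ∀ {m} (F : Similarity (Fin m)) → Algorithm (Fin m) n p (space F)
      correct   : ∀ {m} (F : Similarity (Fin m)) → IsSamplerOn F ε δ (algorithm F)

{-# OPTIONS --safe #-}
module Submission where

open import Defs
open import Data.Bool.Base using (Bool; true; false; if_then_else_; _∧_; not)
open import Data.Fin.Base using (Fin; zero; suc; finToFun; funToFin; splitAt; _↑ˡ_; _↑ʳ_)
import Data.Fin.Properties as Fin
open import Data.List.Base using (foldl; allFin; tabulate; map)
import Data.List.Properties as List
open import Data.Maybe.Base using (Maybe; just; nothing)
import Data.Maybe.Properties as Maybe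
open import Data.Nat.Base as ℕ using (ℕ; zero; suc)
import Data.Nat.Properties as ℕ
open import Data.Product.Base using (_,_; _×_; proj₁; ∃-syntax)
open import Data.Sum.Base using (_⊎_; inj₁; inj₂)
open import Data.Vec.Base as Vec using (Vec; []; _∷_; lookup)
open import Data.Vec.Functional as Vector using (Vector)
import Data.Vec.Properties as Vec
open import Function.Base using (_∘_; id)
open import Function.Bundles using (Inverse)
open import Relation.Binary.Bundles using (Poset)
open import Relation.Binary.PropositionalEquality as ≡ using (_≡_)
open import Relation.Binary.Structures using (IsTotalOrder)
open import Relation.Nullary.Decidable.Core using (does)
open import Relation.Nullary.Negation.Core using (¬_; contradiction)
open import Relation.Unary using (Pred; Decidable)
open import Relation.Unary.Properties using (_∩?_; ∁?)

-- The universe may be arbitrarily large, so let Alice hold a string x of N bits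
-- and Bob an index y < N, with N far larger than any function of n. On the stream
-- x, y, y, …, y, where f x y = 0 if the y-th bit of x is 1 and all other
-- similarities are 1, node 0 has share 1/2 of DI if that bit is 1 and share 1/n if
-- it is 0. Hence the event that node 0 is sampled reveals the bit. With s bits of
-- memory, Bob's part of the stream acts through one of T = ((2^s)^(2^s))^p maps, so
-- for each seed his indices fall into T classes; the bits in a class have random
-- signs, and by a second-moment bound an answer depending only on x and the class
-- has total correlation O(√(N T)) with the bits. This forces N = O(T).

-- Arithmetic of ordered fields, finite sums and indicators.

module OrderedFieldProperties {c ℓ₁ ℓ₂} (K : OrderedField c ℓ₁ ℓ₂) where

  open OrderedField K hiding (sum; zero)
  open IsTotalOrder isTotalOrder public
    using (total; antisym; isPartialOrder)
    renaming (refl to ≤-refl; trans to ≤-trans; reflexive to ≤-reflexive)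
  open import Algebra.Properties.Semiring.Sum semiring public
  open import Algebra.Properties.Semiring.Mult semiring using (×-homo-+; ×1-homo-*)
  open import Algebra.Properties.Ring ring using (-1*x≈-x; -‿involutive)
  open import Algebra.Solver.Ring.NaturalCoefficients.Default commutativeSemiring public
    using (solve; _:=_; _:+_; _:*_)

  ≤-poset : Poset c ℓ₁ ℓ₂
  ≤-poset = record { isPartialOrder = isPartialOrder }

  open import Relation.Binary.Reasoning.PartialOrder ≤-poset public

  +-mono-≤ : ∀ {w x y z} → w ≤ x → y ≤ z → w + y ≤ x + z
  +-mono-≤ {w} {x} {y} {z} w≤x y≤z = begin
    w + y ≤⟨ +-monoʳ-≤ w y≤z ⟩
    w + z ≈⟨ +-comm w z ⟩
    z + w ≤⟨ +-monoʳ-≤ z w≤x ⟩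
    z + x ≈⟨ +-comm z x ⟩
    x + z ∎

  +-cancelˡ-≤ : ∀ x {y z} → x + y ≤ x + z → y ≤ z
  +-cancelˡ-≤ x {y} {z} x+y≤x+z = begin
    y               ≈⟨ undo y ⟩
    - x + (x + y)   ≤⟨ +-monoʳ-≤ (- x) x+y≤x+z ⟩
    - x + (x + z)   ≈⟨ undo z ⟨
    z               ∎
    where
    undo : ∀ y → y ≈ - x + (x + y)
    undo y = sym (trans (sym (+-assoc (- x) x y))
                        (trans (+-congʳ (-‿inverseˡ x)) (+-identityˡ y)))

  x≤x+nonNeg : ∀ {x d} → 0# ≤ d → x ≤ x + d
  x≤x+nonNeg {x} {d} 0≤d = begin
    x      ≈⟨ +-identityʳ x ⟨
    x + 0# ≤⟨ +-monoʳ-≤ x 0≤d ⟩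
    x + d  ∎

  -- Turns an inequality into an equation with an explicit nonnegative slack, to which semiring
  -- identities apply.
  ≤⇒∃+ : ∀ {x y} → x ≤ y → ∃[ d ] 0# ≤ d × y ≈ x + d
  ≤⇒∃+ {x} {y} x≤y = - x + y , nonNeg , sym eq
    where
    nonNeg : 0# ≤ - x + y
    nonNeg = begin
      0#      ≈⟨ -‿inverseˡ x ⟨
      - x + x ≤⟨ +-monoʳ-≤ (- x) x≤y ⟩
      - x + y ∎
    eq : x + (- x + y) ≈ y
    eq = trans (sym (+-assoc x (- x) y))
               (trans (+-congʳ (-‿inverseʳ x)) (+-identityˡ y))

  *-monoʳ-≤ : ∀ {x y z} → 0# ≤ x → y ≤ z → x * y ≤ x * z
  *-monoʳ-≤ {x} {y} {z} 0≤x y≤z with d , 0≤d , z≈y+d ← ≤⇒∃+ y≤z = begin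
    x * y         ≤⟨ x≤x+nonNeg (*-nonNeg 0≤x 0≤d) ⟩
    x * y + x * d ≈⟨ distribˡ x y d ⟨
    x * (y + d)   ≈⟨ *-congˡ z≈y+d ⟨
    x * z         ∎

  *-monoˡ-≤ : ∀ {x y z} → 0# ≤ x → y ≤ z → y * x ≤ z * x
  *-monoˡ-≤ {x} {y} {z} 0≤x y≤z = begin
    y * x ≈⟨ *-comm y x ⟩
    x * y ≤⟨ *-monoʳ-≤ 0≤x y≤z ⟩
    x * z ≈⟨ *-comm x z ⟩
    z * x ∎

  -- The solver knows semirings only, so negation enters its goals as the atom `- 1#`, and this
  -- relation is supplied by hand.
  -1*-1≈1 : - 1# * - 1# ≈ 1#
  -1*-1≈1 = trans (-1*x≈-x (- 1#)) (-‿involutive 1#)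

  x≤0⇒0≤-x : ∀ {x} → x ≤ 0# → 0# ≤ - x
  x≤0⇒0≤-x {x} x≤0 = begin
    0#       ≈⟨ -‿inverseˡ x ⟨
    - x + x  ≤⟨ +-monoʳ-≤ (- x) x≤0 ⟩
    - x + 0# ≈⟨ +-identityʳ (- x) ⟩
    - x      ∎

  square-nonNeg : ∀ x → 0# ≤ x * x
  square-nonNeg x with total 0# x
  ... | inj₁ 0≤x = *-nonNeg 0≤x 0≤x
  ... | inj₂ x≤0 = begin
    0#                   ≤⟨ *-nonNeg 0≤-x 0≤-x ⟩
    - x * - x            ≈⟨ *-cong (-1*x≈-x x) (-1*x≈-x x) ⟨
    - 1# * x * (- 1# * x) ≈⟨ solve 2 (λ v x → (v :* x) :* (v :* x) := (v :* v) :* (x :* x)) refl (- 1#) x ⟩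
    - 1# * - 1# * (x * x) ≈⟨ *-congʳ -1*-1≈1 ⟩
    1# * (x * x)         ≈⟨ *-identityˡ _ ⟩
    x * x                ∎
    where
    0≤-x = x≤0⇒0≤-x x≤0

  0≤1 : 0# ≤ 1#
  0≤1 = ≤-trans (square-nonNeg 1#) (≤-reflexive (*-identityˡ 1#))

  1≰0 : ¬ 1# ≤ 0#
  1≰0 1≤0 = 0≉1 (antisym 0≤1 1≤0)

  1≤x⇒x≉0 : ∀ {x} → 1# ≤ x → ¬ x ≈ 0#
  1≤x⇒x≉0 1≤x x≈0 = 1≰0 (≤-trans 1≤x (≤-reflexive x≈0))

  ⁻¹-nonNeg : ∀ {x} → 0# ≤ x → ¬ x ≈ 0# → 0# ≤ x ⁻¹
  ⁻¹-nonNeg {x} 0≤x x≉0 with total 0# (x ⁻¹)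
  ... | inj₁ 0≤x⁻¹ = 0≤x⁻¹
  ... | inj₂ x⁻¹≤0 = contradiction 1≤0 1≰0
    where
    1≤0 : 1# ≤ 0#
    1≤0 = begin
      1#       ≈⟨ ⁻¹-inverseʳ x≉0 ⟨
      x * x ⁻¹ ≤⟨ *-monoʳ-≤ 0≤x x⁻¹≤0 ⟩
      x * 0#   ≈⟨ zeroʳ x ⟩
      0#       ∎

  -- The factors cancelled later are positive numerals, for which `1# ≤ x` gives both nonnegativity
  -- and invertibility.
  *-cancelˡ-≤ : ∀ {x y z} → 1# ≤ x → x * y ≤ x * z → y ≤ z
  *-cancelˡ-≤ {x} {y} {z} 1≤x xy≤xz = begin
    y              ≈⟨ undo y ⟩
    x ⁻¹ * (x * y) ≤⟨ *-monoʳ-≤ (⁻¹-nonNeg (≤-trans 0≤1 1≤x) x≉0) xy≤xz ⟩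
    x ⁻¹ * (x * z) ≈⟨ undo z ⟨
    z              ∎
    where
    x≉0 = 1≤x⇒x≉0 1≤x
    undo : ∀ y → y ≈ x ⁻¹ * (x * y)
    undo y = sym (trans (sym (*-assoc (x ⁻¹) x y))
      (trans (*-congʳ (trans (*-comm (x ⁻¹) x) (⁻¹-inverseʳ x≉0))) (*-identityˡ y)))

  1⁻¹≈1 : 1# ⁻¹ ≈ 1#
  1⁻¹≈1 = trans (sym (*-identityˡ _)) (⁻¹-inverseʳ (0≉1 ∘ sym))

  2ab≤a²+b² : ∀ a b → a * b + a * b ≤ a * a + b * b
  2ab≤a²+b² a b = begin
    a * b + a * b                       ≤⟨ x≤x+nonNeg (square-nonNeg d) ⟩
    -- Replacing `a` by `d + b` removes the subtraction, so a semiring identity finishes the proof.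
    a * b + a * b + d * d               ≈⟨ +-congʳ (+-cong (*-congʳ a≈) (*-congʳ a≈)) ⟩
    (d + b) * b + (d + b) * b + d * d   ≈⟨ solve 2 (λ d b → (d :+ b) :* b :+ (d :+ b) :* b :+ d :* d
                                                     := (d :+ b) :* (d :+ b) :+ b :* b) refl d b ⟩
    (d + b) * (d + b) + b * b           ≈⟨ +-congʳ (*-cong a≈ a≈) ⟨
    a * a + b * b                       ∎
    where
    d = a + - b
    a≈ : a ≈ d + b
    a≈ = sym (trans (+-assoc a (- b) b) (trans (+-congˡ (-‿inverseˡ b)) (+-identityʳ a)))

  fromℕ-+ : ∀ m n → fromℕ (m ℕ.+ n) ≈ fromℕ m + fromℕ n
  fromℕ-+ = ×-homo-+ 1#

  fromℕ-* : ∀ m n → fromℕ (m ℕ.* n) ≈ fromℕ m * fromℕ n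
  fromℕ-* = ×1-homo-*

  fromℕ-nonNeg : ∀ n → 0# ≤ fromℕ n
  fromℕ-nonNeg zero    = ≤-refl
  fromℕ-nonNeg (suc n) = ≤-trans 0≤1 (x≤x+nonNeg (fromℕ-nonNeg n))

  fromℕ-mono-≤ : ∀ {m n} → m ℕ.≤ n → fromℕ m ≤ fromℕ n
  fromℕ-mono-≤ {n = n} ℕ.z≤n = fromℕ-nonNeg n
  fromℕ-mono-≤ (ℕ.s≤s m≤n)   = +-monoʳ-≤ 1# (fromℕ-mono-≤ m≤n)

  1≤fromℕ-suc : ∀ n → 1# ≤ fromℕ (suc n)
  1≤fromℕ-suc n = x≤x+nonNeg (fromℕ-nonNeg n)

  -- Brings the final inequality from the field back to natural numbers. A successor never maps
  -- below zero because `1≰0`.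
  fromℕ-cancel-≤ : ∀ {m n} → fromℕ m ≤ fromℕ n → m ℕ.≤ n
  fromℕ-cancel-≤ {zero}          _   = ℕ.z≤n
  fromℕ-cancel-≤ {suc m} {zero}  leq = contradiction (≤-trans (1≤fromℕ-suc m) leq) 1≰0
  fromℕ-cancel-≤ {suc m} {suc n} leq = ℕ.s≤s (fromℕ-cancel-≤ (+-cancelˡ-≤ 1# leq))

  /ℕ-inverse : ∀ a b → fromℕ (suc b) * (a /ℕ suc b) ≈ fromℕ a
  /ℕ-inverse a b = begin-equality
    d * (fromℕ a * d ⁻¹) ≈⟨ solve 3 (λ d a i → d :* (a :* i) := a :* (d :* i)) refl d (fromℕ a) (d ⁻¹) ⟩
    fromℕ a * (d * d ⁻¹) ≈⟨ *-congˡ (⁻¹-inverseʳ (1≤x⇒x≉0 (1≤fromℕ-suc b))) ⟩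
    fromℕ a * 1#         ≈⟨ *-identityʳ _ ⟩
    fromℕ a              ∎
    where d = fromℕ (suc b)

  sum-mono : ∀ {n} {u v : Vector Carrier n} → (∀ i → u i ≤ v i) → sum u ≤ sum v
  sum-mono {zero}  u≤v = ≤-refl
  sum-mono {suc n} u≤v = +-mono-≤ (u≤v zero) (sum-mono (u≤v ∘ suc))

  sum-const : ∀ n {v : Vector Carrier n} {x} → (∀ i → v i ≈ x) → sum v ≈ fromℕ n * x
  sum-const zero    {x = x} v≈x = sym (zeroˡ x)
  sum-const (suc n) {v} {x} v≈x = begin-equality
    v zero + sum (v ∘ suc)  ≈⟨ +-cong (v≈x zero) (sum-const n (v≈x ∘ suc)) ⟩
    x + fromℕ n * x         ≈⟨ +-congʳ (*-identityˡ x) ⟨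
    1# * x + fromℕ n * x    ≈⟨ distribʳ x 1# (fromℕ n) ⟨
    (1# + fromℕ n) * x      ∎

  ⟦_⟧ : Bool → Carrier
  ⟦ b ⟧ = if b then 1# else 0#

  ⟦⟧-* : ∀ b x → (if b then x else 0#) ≈ x * ⟦ b ⟧
  ⟦⟧-* true  x = sym (*-identityʳ x)
  ⟦⟧-* false x = sym (zeroʳ x)

  ⟦⟧²≈⟦⟧ : ∀ b → ⟦ b ⟧ * ⟦ b ⟧ ≈ ⟦ b ⟧
  ⟦⟧²≈⟦⟧ true  = *-identityˡ 1#
  ⟦⟧²≈⟦⟧ false = zeroˡ 0#

  ⟦⟧≤1 : ∀ b → ⟦ b ⟧ ≤ 1#
  ⟦⟧≤1 true  = ≤-refl
  ⟦⟧≤1 false = 0≤1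

  δ : ∀ {n} → Fin n → Fin n → Carrier
  δ i j = ⟦ does (i Fin.≟ j) ⟧

  sum-δ : ∀ {n} i (v : Vector Carrier n) → ∑[ j < n ] (δ i j * v j) ≈ v i
  sum-δ {suc n} zero v = begin-equality
    1# * v zero + ∑[ j < n ] (0# * v (suc j)) ≈⟨ +-cong (*-identityˡ _) (sum-const n (λ j → zeroˡ _)) ⟩
    v zero + fromℕ n * 0#                     ≈⟨ +-congˡ (zeroʳ _) ⟩
    v zero + 0#                               ≈⟨ +-identityʳ _ ⟩
    v zero                                    ∎
  sum-δ {suc n} (suc i) v = begin-equality
    0# * v zero + ∑[ j < n ] (δ i j * v (suc j)) ≈⟨ +-cong (zeroˡ _) (sum-δ i (v ∘ suc)) ⟩
    0# + v (suc i)                               ≈⟨ +-identityˡ _ ⟩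
    v (suc i)                                    ∎

-- Averages over uniformly random bit strings.

module IndexProblem {c ℓ₁ ℓ₂} (K : OrderedField c ℓ₁ ℓ₂) where

  open OrderedField K hiding (sum; zero)
  open OrderedFieldProperties K

  half : Carrier
  half = (1# + 1#) ⁻¹

  0≤half : 0# ≤ half
  0≤half = ⁻¹-nonNeg (≤-trans 0≤1 (x≤x+nonNeg 0≤1)) (1≤x⇒x≉0 (x≤x+nonNeg 0≤1))

  half-double : ∀ x → half * (x + x) ≈ x
  half-double x = begin-equality
    half * (x + x)           ≈⟨ *-congˡ (+-cong (*-identityˡ x) (*-identityˡ x)) ⟨
    half * (1# * x + 1# * x) ≈⟨ solve 3 (λ h o x → h :* (o :* x :+ o :* x) := (o :+ o) :* h :* x) refl half 1# x ⟩
    (1# + 1#) * half * x     ≈⟨ *-congʳ (⁻¹-inverseʳ (1≤x⇒x≉0 (x≤x+nonNeg 0≤1))) ⟩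
    1# * x                  ≈⟨ *-identityˡ x ⟩
    x                       ∎

  -- Expectation over a uniform string, defined by averaging out the first bit so that moments can
  -- be computed by induction.
  average : ∀ n → (Vec Bool n → Carrier) → Carrier
  average zero    g = g []
  average (suc n) g = half * (average n (g ∘ (true ∷_)) + average n (g ∘ (false ∷_)))

  average-mono : ∀ n {g h : Vec Bool n → Carrier} → (∀ x → g x ≤ h x) → average n g ≤ average n h
  average-mono zero    g≤h = g≤h []
  average-mono (suc n) g≤h = *-monoʳ-≤ 0≤half
    (+-mono-≤ (average-mono n (g≤h ∘ (true ∷_))) (average-mono n (g≤h ∘ (false ∷_))))

  average-cong : ∀ n {g h : Vec Bool n → Carrier} → (∀ x → g x ≈ h x) → average n g ≈ average n h
  average-cong zero    g≈h = g≈h []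
  average-cong (suc n) g≈h = *-congˡ
    (+-cong (average-cong n (g≈h ∘ (true ∷_))) (average-cong n (g≈h ∘ (false ∷_))))

  average-const : ∀ n x → average n (λ _ → x) ≈ x
  average-const zero    x = refl
  average-const (suc n) x =
    trans (*-congˡ (+-cong (average-const n x) (average-const n x))) (half-double x)

  average-+ : ∀ n (g h : Vec Bool n → Carrier) →
              average n (λ x → g x + h x) ≈ average n g + average n h
  average-+ zero    g h = refl
  average-+ (suc n) g h = trans (*-congˡ (+-cong (average-+ n _ _) (average-+ n _ _)))
    (solve 5 (λ k a b c d → k :* ((a :+ b) :+ (c :+ d)) := k :* (a :+ c) :+ k :* (b :+ d)) refl half _ _ _ _)

  average-*ˡ : ∀ n k (g : Vec Bool n → Carrier) → average n (λ x → k * g x) ≈ k * average n g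
  average-*ˡ zero    k g = refl
  average-*ˡ (suc n) k g = trans (*-congˡ (+-cong (average-*ˡ n k _) (average-*ˡ n k _)))
    (solve 4 (λ h k a b → h :* (k :* a :+ k :* b) := k :* (h :* (a :+ b))) refl half k _ _)

  average-sum : ∀ n {r} (g : Fin r → Vec Bool n → Carrier) →
                average n (λ x → ∑[ i < r ] g i x) ≈ ∑[ i < r ] average n (g i)
  average-sum n {zero}  g = average-const n 0#
  average-sum n {suc r} g = trans (average-+ n _ _) (+-congˡ (average-sum n (g ∘ suc)))

  -- First and second moments of sums of random signs.

  sgn : Bool → Carrier
  sgn b = if b then 1# else - 1#

  signedSum : ∀ {n} → Vector Carrier n → Vec Bool n → Carrier
  signedSum {n} a x = ∑[ y < n ] (a y * sgn (lookup x y))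

  -- The two values of the first bit contribute opposite terms, which cancel; the offset `b` keeps
  -- the induction hypothesis applicable.
  average-signedSum : ∀ n (a : Vector Carrier n) b → average n (λ x → b + signedSum a x) ≈ b
  average-signedSum zero    a b = +-identityʳ b
  average-signedSum (suc n) a b = begin-equality
    half * (average n (λ x → b + (a zero * 1# + signedSum (a ∘ suc) x)) +
            average n (λ x → b + (a zero * - 1# + signedSum (a ∘ suc) x)))
      ≈⟨ *-congˡ (+-cong (shift 1#) (shift (- 1#))) ⟩
    half * ((b + a zero * 1#) + (b + a zero * - 1#))
      ≈⟨ *-congˡ (solve 4 (λ b a s t → (b :+ a :* s) :+ (b :+ a :* t) := (b :+ b) :+ a :* (s :+ t))
                    refl b (a zero) 1# (- 1#)) ⟩
    half * ((b + b) + a zero * (1# + - 1#))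
      ≈⟨ *-congˡ (+-congˡ (trans (*-congˡ (-‿inverseʳ 1#)) (zeroʳ _))) ⟩
    half * ((b + b) + 0#)
      ≈⟨ *-congˡ (+-identityʳ _) ⟩
    half * (b + b)
      ≈⟨ half-double b ⟩
    b ∎
    where
    shift : ∀ s → average n (λ x → b + (a zero * s + signedSum (a ∘ suc) x)) ≈ b + a zero * s
    shift s = trans (average-cong n (λ x → sym (+-assoc _ _ _))) (average-signedSum n _ _)

  -- Generalised to an offset b, which absorbs the coordinates already averaged out.
  average-signedSum² : ∀ n (a : Vector Carrier n) b →
    average n (λ x → (b + signedSum a x) * (b + signedSum a x)) ≈ b * b + ∑[ y < n ] (a y * a y)
  average-signedSum² zero    a b =
    trans (*-cong (+-identityʳ b) (+-identityʳ b)) (sym (+-identityʳ _))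
  average-signedSum² (suc n) a b = begin-equality
    half * (average n (square 1#) + average n (square (- 1#)))
      ≈⟨ *-congˡ (+-cong (shift 1#) (shift (- 1#))) ⟩
    half * (((b + a₀ * 1#) * (b + a₀ * 1#) + r) + ((b + a₀ * - 1#) * (b + a₀ * - 1#) + r))
      -- The cross terms of the two squares collect into a multiple of `s + t`, which is zero for
      -- opposite signs.
      ≈⟨ *-congˡ (solve 5 (λ b a s t r →
           ((b :+ a :* s) :* (b :+ a :* s) :+ r) :+ ((b :+ a :* t) :* (b :+ a :* t) :+ r) :=
           (b :* b :+ a :* a :* (s :* s) :+ r) :+ (b :* b :+ a :* a :* (t :* t) :+ r) :+
           (b :* a :+ b :* a) :* (s :+ t)) refl b a₀ 1# (- 1#) r) ⟩
    half * ((b * b + a₀ * a₀ * (1# * 1#) + r) + (b * b + a₀ * a₀ * (- 1# * - 1#) + r) +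
            (b * a₀ + b * a₀) * (1# + - 1#))
      ≈⟨ *-congˡ (+-cong (+-cong (sq (*-identityˡ 1#)) (sq -1*-1≈1))
                         (trans (*-congˡ (-‿inverseʳ 1#)) (zeroʳ _))) ⟩
    half * ((b * b + a₀ * a₀ + r) + (b * b + a₀ * a₀ + r) + 0#)
      ≈⟨ *-congˡ (+-identityʳ _) ⟩
    half * ((b * b + a₀ * a₀ + r) + (b * b + a₀ * a₀ + r))
      ≈⟨ half-double _ ⟩
    b * b + a₀ * a₀ + r
      ≈⟨ +-assoc _ _ _ ⟩
    b * b + (a₀ * a₀ + r) ∎
    where
    a₀ = a zero
    r = ∑[ y < n ] (a (suc y) * a (suc y))
    square : Carrier → Vec Bool n → Carrier
    square s x = (b + (a₀ * s + signedSum (a ∘ suc) x)) * (b + (a₀ * s + signedSum (a ∘ suc) x))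
    shift : ∀ s → average n (square s) ≈ (b + a₀ * s) * (b + a₀ * s) + r
    shift s = trans (average-cong n (λ x → *-cong (sym (+-assoc _ _ _)) (sym (+-assoc _ _ _))))
                    (average-signedSum² n _ _)
    sq : ∀ {s} → s * s ≈ 1# → b * b + a₀ * a₀ * (s * s) + r ≈ b * b + a₀ * a₀ + r
    sq s²≈1 = +-congʳ (+-congˡ (trans (*-congˡ s²≈1) (*-identityʳ _)))

  -- Correlation with answers that are constant on classes.

  fibreSum : ∀ {n t} → (Fin n → Fin t) → Vector Carrier n → Fin t → Carrier
  fibreSum {n} κ v j = ∑[ y < n ] (δ (κ y) j * v y)

  -- Regroups a sum by classes: after exchanging the sums, `δ` selects the class of each index.
  sum-fibreSum : ∀ {n t} (κ : Fin n → Fin t) v (g : Fin t → Carrier) →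
                 ∑[ j < t ] (fibreSum κ v j * g j) ≈ ∑[ y < n ] (v y * g (κ y))
  sum-fibreSum {n} {t} κ v g = begin-equality
    ∑[ j < t ] (fibreSum κ v j * g j)
      ≈⟨ sum-cong-≋ {t} (λ j → *-distribʳ-sum {n} (g j) _) ⟩
    ∑[ j < t ] ∑[ y < n ] (δ (κ y) j * v y * g j)
      ≈⟨ ∑-comm (λ j y → δ (κ y) j * v y * g j) ⟩
    ∑[ y < n ] ∑[ j < t ] (δ (κ y) j * v y * g j)
      ≈⟨ sum-cong-≋ {n} (λ y → trans (sum-cong-≋ {t} (λ j → *-assoc _ _ _)) (sum-δ (κ y) (λ j → v y * g j))) ⟩
    ∑[ y < n ] (v y * g (κ y)) ∎

  -- `D j` is the number of ones minus the number of zeros of `x` within class `j`.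
  imbalance : ∀ {n t} → (Fin n → Fin t) → Vec Bool n → Carrier
  imbalance {t = t} κ x = ∑[ j < t ] (D j * D j)
    where
    D : Fin t → Carrier
    D = fibreSum κ (sgn ∘ lookup x)

  -- Each class sum is a signed sum with coefficients 0 and 1, so its second moment is the size of
  -- the class, and the sizes add up to `n` however many classes there are.
  average-imbalance : ∀ {n t} (κ : Fin n → Fin t) → average n (imbalance κ) ≈ fromℕ n
  average-imbalance {n} {t} κ = begin-equality
    average n (imbalance κ)
      ≈⟨ average-sum n {t} _ ⟩
    ∑[ j < t ] average n (λ x → signedSum (a j) x * signedSum (a j) x)
      ≈⟨ sum-cong-≋ {t} (λ j → trans (average-cong n (λ x → sym (*-cong (+-identityˡ _) (+-identityˡ _))))
                              (trans (average-signedSum² n (a j) 0#)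
                                     (trans (+-congʳ (zeroˡ 0#)) (+-identityˡ _)))) ⟩
    ∑[ j < t ] ∑[ y < n ] (a j y * a j y)
      ≈⟨ ∑-comm (λ j y → a j y * a j y) ⟩
    ∑[ y < n ] ∑[ j < t ] (a j y * a j y)
      ≈⟨ sum-const n (λ y → trans (sum-cong-≋ {t} (λ j → trans (⟦⟧²≈⟦⟧ _) (sym (*-identityʳ _))))
                                  (sum-δ (κ y) (λ _ → 1#))) ⟩
    fromℕ n * 1#
      ≈⟨ *-identityʳ _ ⟩
    fromℕ n ∎
    where
    a : Fin t → Vector Carrier n
    a j y = δ (κ y) j

  -- AM–GM applied fibre by fibre: 2 D l q ≤ D² + l² q² with q ∈ {0, 1}.
  correlation-bound : ∀ {n t} (κ : Fin n → Fin t) (answer : Fin t → Bool) x l →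
    ∑[ y < n ] (sgn (lookup x y) * ((l + l) * ⟦ answer (κ y) ⟧)) ≤ imbalance κ x + l * l * fromℕ t
  correlation-bound {n} {t} κ answer x l = begin
    ∑[ y < n ] (sgn (lookup x y) * ((l + l) * ⟦ answer (κ y) ⟧))
      ≈⟨ sum-fibreSum κ (sgn ∘ lookup x) (λ j → (l + l) * ⟦ answer j ⟧) ⟨
    ∑[ j < t ] (D j * ((l + l) * ⟦ answer j ⟧))
      ≤⟨ sum-mono (λ j → fibre (D j) (answer j)) ⟩
    ∑[ j < t ] (D j * D j + l * l)
      ≈⟨ ∑-distrib-+ (λ j → D j * D j) (λ _ → l * l) ⟩
    imbalance κ x + ∑[ j < t ] (l * l)
      ≈⟨ +-congˡ (trans (sum-const t (λ _ → refl)) (*-comm _ _)) ⟩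
    imbalance κ x + l * l * fromℕ t ∎
    where
    D : Fin t → Carrier
    D = fibreSum κ (sgn ∘ lookup x)
    fibre : ∀ d b → d * ((l + l) * ⟦ b ⟧) ≤ d * d + l * l
    fibre d b = begin
      d * ((l + l) * ⟦ b ⟧)
        ≈⟨ solve 3 (λ d l q → d :* ((l :+ l) :* q) := d :* (l :* q) :+ d :* (l :* q)) refl d l ⟦ b ⟧ ⟩
      d * (l * ⟦ b ⟧) + d * (l * ⟦ b ⟧)
        ≤⟨ 2ab≤a²+b² d (l * ⟦ b ⟧) ⟩
      d * d + l * ⟦ b ⟧ * (l * ⟦ b ⟧)
        ≈⟨ +-congˡ (trans (solve 2 (λ l q → l :* q :* (l :* q) := l :* l :* (q :* q)) refl l ⟦ b ⟧)
                          (*-congˡ (⟦⟧²≈⟦⟧ b))) ⟩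
      d * d + l * l * ⟦ b ⟧
        ≤⟨ +-monoʳ-≤ (d * d) (*-monoʳ-≤ (square-nonNeg l) (⟦⟧≤1 b)) ⟩
      d * d + l * l * 1#
        ≈⟨ +-congˡ (*-identityʳ _) ⟩
      d * d + l * l ∎

  -- Bob reveals only the class κ ω y of his index y, Alice holds the string x.
  module _ {r n t : ℕ} (μ : Distribution K r)
           (κ : Fin r → Fin n → Fin t) (answer : Fin r → Vec Bool n → Fin t → Bool) where

    open Distribution μ

    -- The probability of a positive answer, in the form to which `Pr` unfolds.
    accept : Vec Bool n → Fin n → Carrier
    accept x y = ∑[ ω < r ] (if answer ω x (κ ω y) then mass ω else 0#)

    module _ (l : Carrier)
             (high : ∀ x y → lookup x y ≡ true → 1# + 1# ≤ l * accept x y)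
             (low  : ∀ x y → lookup x y ≡ false → l * accept x y ≤ 1#) where

      private
        -- AM-GM with weight `l` would give only n ≤ n + l² t. Weight 2l raises the left side to 2n,
        -- so that n survives after the mean imbalance is subtracted.
        L : Carrier
        L = l + l

      three : Carrier
      three = 1# + 1# + 1#

      -- The thresholds 1 and 2 are centred at 3/2: `sgn b` times 2q - 3 is at least 1 in both
      -- cases. The centring term stays on the left, where it later averages to zero.
      advantage : ∀ b q → (b ≡ true → 1# + 1# ≤ q) → (b ≡ false → q ≤ 1#) →
                  1# + three * sgn b ≤ sgn b * (q + q)
      advantage true q 2≤q _ = begin
        1# + three * 1#       ≈⟨ +-congˡ (*-identityʳ three) ⟩
        1# + three            ≈⟨ solve 1 (λ o → o :+ (o :+ o :+ o) := (o :+ o) :+ (o :+ o)) refl 1# ⟩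
        (1# + 1#) + (1# + 1#) ≤⟨ +-mono-≤ (2≤q ≡.refl) (2≤q ≡.refl) ⟩
        q + q                 ≈⟨ *-identityˡ _ ⟨
        1# * (q + q)          ∎
      advantage false q _ q≤1 with d , 0≤d , 1≈q+d ← ≤⇒∃+ (q≤1 ≡.refl) = begin
        1# + three * v
          -- `1#` is an atom for the solver, so the identity is made homogeneous first; the factor
          -- `1# + v` that it produces is zero.
          ≈⟨ +-congʳ (*-identityʳ 1#) ⟨
        1# * 1# + three * v
          ≈⟨ solve 2 (λ o v → o :* o :+ (o :+ o :+ o) :* v := o :* (o :+ v) :+ v :* (o :+ o)) refl 1# v ⟩
        1# * (1# + v) + v * (1# + 1#)
          ≈⟨ trans (+-congʳ (trans (*-congˡ (-‿inverseʳ 1#)) (zeroʳ 1#))) (+-identityˡ _) ⟩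
        v * (1# + 1#)
          ≤⟨ x≤x+nonNeg (*-nonNeg 0≤1 (≤-trans 0≤d (x≤x+nonNeg 0≤d))) ⟩
        v * (1# + 1#) + 1# * (d + d)
          ≈⟨ +-congʳ (*-congˡ (+-cong 1≈q+d 1≈q+d)) ⟩
        v * ((q + d) + (q + d)) + 1# * (d + d)
          ≈⟨ solve 4 (λ v q d o → v :* ((q :+ d) :+ (q :+ d)) :+ o :* (d :+ d)
                               := v :* (q :+ q) :+ (o :+ v) :* (d :+ d)) refl v q d 1# ⟩
        v * (q + q) + (1# + v) * (d + d)
          ≈⟨ trans (+-congˡ (trans (*-congʳ (-‿inverseʳ 1#)) (zeroˡ _))) (+-identityʳ _) ⟩
        v * (q + q) ∎
        where v = - 1#

      correlation : Fin r → Vec Bool n → Carrier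
      correlation ω x = ∑[ y < n ] (sgn (lookup x y) * ((L + L) * ⟦ answer ω x (κ ω y) ⟧))

      -- Exchanging the sums over indices and seeds lets `correlation-bound` be applied to the fixed
      -- partition of each seed.
      expected-correlation : ∀ x →
        ∑[ y < n ] (sgn (lookup x y) * ((l * accept x y + l * accept x y) + (l * accept x y + l * accept x y)))
          ≈ ∑[ ω < r ] (mass ω * correlation ω x)
      expected-correlation x = begin-equality
        ∑[ y < n ] (s y * ((l * accept x y + l * accept x y) + (l * accept x y + l * accept x y)))
          ≈⟨ sum-cong-≋ {n} (λ y → trans
               (solve 3 (λ s l a → s :* ((l :* a :+ l :* a) :+ (l :* a :+ l :* a))
                                := s :* ((l :+ l) :+ (l :+ l)) :* a) refl (s y) l (accept x y))
               (*-distribˡ-sum {r} (s y * (L + L)) _)) ⟩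
        ∑[ y < n ] ∑[ ω < r ] (s y * (L + L) * (if q ω y then mass ω else 0#))
          ≈⟨ ∑-comm (λ y ω → s y * (L + L) * (if q ω y then mass ω else 0#)) ⟩
        ∑[ ω < r ] ∑[ y < n ] (s y * (L + L) * (if q ω y then mass ω else 0#))
          ≈⟨ sum-cong-≋ {r} (λ ω → trans
               (sum-cong-≋ {n} (λ y → trans (*-congˡ (⟦⟧-* (q ω y) (mass ω)))
                 (solve 4 (λ s k m q → s :* k :* (m :* q) := m :* (s :* (k :* q))) refl (s y) (L + L) (mass ω) ⟦ q ω y ⟧)))
               (sym (*-distribˡ-sum {n} (mass ω) _))) ⟩
        ∑[ ω < r ] (mass ω * correlation ω x) ∎
        where
        s : Fin n → Carrier
        s y = sgn (lookup x y)
        q : Fin r → Fin n → Bool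
        q ω y = answer ω x (κ ω y)

      meanImbalance : Vec Bool n → Carrier
      meanImbalance x = ∑[ ω < r ] (mass ω * imbalance (κ ω) x)

      2n : Carrier
      2n = fromℕ n + fromℕ n

      -- Adds up `advantage`, taken twice, over all indices. The signed sum may be large for a
      -- single `x`; only averaging removes it.
      pointwise : ∀ x → 2n + signedSum (λ _ → three + three) x ≤ meanImbalance x + L * L * fromℕ t
      pointwise x = begin
        2n + signedSum (λ _ → three + three) x
          ≈⟨ +-congʳ (trans (sum-const n (λ _ → refl)) (trans (distribˡ _ _ _) (+-cong (*-identityʳ _) (*-identityʳ _)))) ⟨
        ∑[ y < n ] (1# + 1#) + signedSum (λ _ → three + three) x
          ≈⟨ ∑-distrib-+ {n} (λ _ → 1# + 1#) _ ⟨
        ∑[ y < n ] ((1# + 1#) + (three + three) * s y)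
          ≈⟨ sum-cong-≋ {n} (λ y → solve 3 (λ o k s → (o :+ o) :+ (k :+ k) :* s := (o :+ k :* s) :+ (o :+ k :* s))
                                 refl 1# three (s y)) ⟩
        ∑[ y < n ] ((1# + three * s y) + (1# + three * s y))
          ≤⟨ sum-mono (λ y → let a = advantage (lookup x y) (l * accept x y) (high x y) (low x y) in +-mono-≤ a a) ⟩
        ∑[ y < n ] (s y * Q y + s y * Q y)
          ≈⟨ sum-cong-≋ {n} (λ y → distribˡ (s y) (Q y) (Q y)) ⟨
        ∑[ y < n ] (s y * (Q y + Q y))
          ≈⟨ expected-correlation x ⟩
        ∑[ ω < r ] (mass ω * correlation ω x)
          ≤⟨ sum-mono (λ ω → *-monoʳ-≤ (mass-nonNeg ω) (correlation-bound (κ ω) (answer ω x) x L)) ⟩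
        ∑[ ω < r ] (mass ω * (imbalance (κ ω) x + L * L * fromℕ t))
          ≈⟨ trans (sum-cong-≋ {r} (λ ω → distribˡ (mass ω) _ _)) (∑-distrib-+ {r} _ _) ⟩
        meanImbalance x + ∑[ ω < r ] (mass ω * (L * L * fromℕ t))
          ≈⟨ +-congˡ (trans (sym (*-distribʳ-sum (L * L * fromℕ t) mass))
                            (trans (*-congʳ mass-total) (*-identityˡ _))) ⟩
        meanImbalance x + L * L * fromℕ t ∎
        where
        s Q : Fin n → Carrier
        s y = sgn (lookup x y)
        Q y = l * accept x y + l * accept x y

      -- The classes depend on the seed but not on `x`, so the string is still uniform once the seed
      -- is fixed.
      average-meanImbalance : average n meanImbalance ≈ fromℕ n
      average-meanImbalance = begin-equality
        average n meanImbalance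
          ≈⟨ average-sum n {r} _ ⟩
        ∑[ ω < r ] average n (λ x → mass ω * imbalance (κ ω) x)
          ≈⟨ sum-cong-≋ {r} (λ ω → trans (average-*ˡ n (mass ω) _) (*-congˡ (average-imbalance (κ ω)))) ⟩
        ∑[ ω < r ] (mass ω * fromℕ n)
          ≈⟨ *-distribʳ-sum (fromℕ n) mass ⟨
        sum mass * fromℕ n
          ≈⟨ trans (*-congʳ mass-total) (*-identityˡ _) ⟩
        fromℕ n ∎

      -- Averaging `pointwise` removes the signed sum and turns the mean imbalance into `n`, which
      -- cancels one half of `2n`.
      index-bound : fromℕ n ≤ L * L * fromℕ t
      index-bound = +-cancelˡ-≤ (fromℕ n) (begin
        2n
          ≈⟨ average-signedSum n (λ _ → three + three) 2n ⟨
        average n (λ x → 2n + signedSum (λ _ → three + three) x)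
          ≤⟨ average-mono n pointwise ⟩
        average n (λ x → meanImbalance x + L * L * fromℕ t)
          ≈⟨ trans (average-+ n _ _) (+-cong average-meanImbalance (average-const n _)) ⟩
        fromℕ n + L * L * fromℕ t ∎)

-- Memory states and Bob's behaviours as finite types.

open Inverse Fin.2↔Bool using () renaming (to to toBool; from to fromBool; strictlyInverseˡ to toBool-fromBool)

encode : ∀ {n} → Vec Bool n → Fin (2 ℕ.^ n)
encode v = funToFin (fromBool ∘ lookup v)

decode : ∀ {n} → Fin (2 ℕ.^ n) → Vec Bool n
decode {n} i = Vec.tabulate (toBool ∘ finToFun {2} {n} i)

decode-encode : ∀ {n} (v : Vec Bool n) → decode (encode v) ≡ v
decode-encode {n} v = ≡.trans
  (Vec.tabulate-cong (λ i → ≡.trans (≡.cong toBool (Fin.finToFun-funToFin (fromBool ∘ lookup v) i))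
                                    (toBool-fromBool (lookup v i))))
  (Vec.tabulate∘lookup v)

-- The nesting of powers follows `funToFin`: for each of `p` passes, one map on the `2 ^ s` memory
-- states.
behaviours : ℕ → ℕ → ℕ
behaviours p s = ((2 ℕ.^ s) ℕ.^ (2 ℕ.^ s)) ℕ.^ p

behaviours-mono : ∀ p {s t} → s ℕ.≤ t → behaviours p s ℕ.≤ behaviours p t
behaviours-mono p {s} {t} s≤t = ℕ.^-monoˡ-≤ p (ℕ.≤-trans
  (ℕ.^-monoˡ-≤ (2 ℕ.^ s) 2^s≤2^t)
  (ℕ.^-monoʳ-≤ (2 ℕ.^ t) {{ℕ.m^n≢0 2 t}} 2^s≤2^t))
  where
  2^s≤2^t : 2 ℕ.^ s ℕ.≤ 2 ℕ.^ t
  2^s≤2^t = ℕ.^-monoʳ-≤ 2 s≤t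

stream : ∀ {U : Set} {n} → U → U → Vector U (suc n)
stream {n = n} u v = u Vector.∷ Vector.replicate n v

-- Reduction of a streaming run to one message from Bob.

module TwoParty {c ℓ₁ ℓ₂} {K : OrderedField c ℓ₁ ℓ₂} {U : Set} {n p s : ℕ}
                (A : Algorithm K U (suc n) p s) where

  open Algorithm A

  bobPass : Fin seeds → U → Fin p → Vec Bool s → Vec Bool s
  bobPass ω v k m = foldl (λ m i → step ω k (suc i) v m) m (allFin n)

  -- Bob's message tabulates his action on every memory state in every pass, so it does not depend
  -- on Alice's item.
  behaviour : Fin seeds → U → Fin (behaviours p s)
  behaviour ω v = funToFin (λ k → funToFin (encode ∘ bobPass ω v k ∘ decode))

  perform : Fin (behaviours p s) → Fin p → Vec Bool s → Vec Bool s
  perform b k m = decode (finToFun {n = 2 ℕ.^ s} (finToFun {n = p} b k) (encode m))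

  perform-behaviour : ∀ ω v k m → perform (behaviour ω v) k m ≡ bobPass ω v k m
  perform-behaviour ω v k m = begin
    decode (finToFun {n = 2 ℕ.^ s} (finToFun {n = p} (behaviour ω v) k) (encode m))
      ≡⟨ ≡.cong (λ b → decode (finToFun {n = 2 ℕ.^ s} b (encode m)))
           (Fin.finToFun-funToFin (λ k → funToFin (encode ∘ bobPass ω v k ∘ decode)) k) ⟩
    decode (finToFun {n = 2 ℕ.^ s} (funToFin (encode ∘ bobPass ω v k ∘ decode)) (encode m))
      ≡⟨ ≡.cong decode (Fin.finToFun-funToFin (encode ∘ bobPass ω v k ∘ decode) (encode m)) ⟩
    decode (encode (bobPass ω v k (decode (encode m))))
      ≡⟨ decode-encode _ ⟩
    bobPass ω v k (decode (encode m))
      ≡⟨ ≡.cong (bobPass ω v k) (decode-encode m) ⟩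
    bobPass ω v k m ∎
    where open ≡.≡-Reasoning

  -- With all of Bob's maps in hand, Alice simulates every pass herself, so several passes still
  -- cost a single message.
  alice : Fin seeds → U → Fin (behaviours p s) → Maybe (Fin (suc n))
  alice ω u b = output ω (foldl (λ m k → perform b k (step ω k zero u m)) (start ω) (allFin p))

  run-stream : ∀ ω u v → run ω (stream u v) ≡ alice ω u (behaviour ω v)
  run-stream ω u v = ≡.cong (output ω) (List.foldl-cong pass (start ω) (allFin p))
    where
    open ≡.≡-Reasoning
    pass : ∀ m k → runPass ω (stream u v) m k ≡ perform (behaviour ω v) k (step ω k zero u m)
    pass m k = begin
      -- Unfolding `allFin (suc n)` has already performed Alice's step at position `zero`; the
      -- remaining positions are Bob's.
      foldl f m₁ (tabulate suc)              ≡⟨ ≡.cong (foldl f m₁) (List.map-tabulate id suc) ⟨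
      foldl f m₁ (map suc (allFin n))        ≡⟨ List.foldl-map f suc m₁ (allFin n) ⟩
      bobPass ω v k m₁                       ≡⟨ perform-behaviour ω v k m₁ ⟨
      perform (behaviour ω v) k m₁ ∎
      where
      m₁ : Vec Bool s
      m₁ = step ω k zero u m
      f : Vec Bool s → Fin (suc n) → Vec Bool s
      f m i = step ω k i (stream u v i) m

-- The second conjunct mirrors the conditioning on success in `outputProb`, so that `accept` and
-- `sampleProb` unfold to matching sums.
isNode : ∀ {n} → Fin n → Maybe (Fin n) → Bool
isNode i o = does (Maybe.≡-dec Fin._≟_ o (just i)) ∧ not (does (Maybe.≡-dec Fin._≟_ o nothing))

-- How likely a sampler outputs node 0.

module SamplerBounds {c ℓ₁ ℓ₂} (K : OrderedField c ℓ₁ ℓ₂) where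

  open OrderedField K hiding (sum; zero)
  open OrderedFieldProperties K
  open IndexProblem K using (half; half-double)

  module _ {r : ℕ} (μ : Distribution K r) where
    open Distribution μ

    Pr-∁ : ∀ {ℓ} {E : Pred (Fin r) ℓ} (E? : Decidable E) → Pr E? + Pr (∁? E?) ≈ 1#
    Pr-∁ E? = trans (sym (∑-distrib-+ {r} _ _)) (trans (sum-cong-≋ {r} (λ ω → split (does (E? ω)) (mass ω))) mass-total)
      where
      split : ∀ b m → (if b then m else 0#) + (if not b then m else 0#) ≈ m
      split true  m = +-identityʳ m
      split false m = +-identityˡ m

    Pr-nonNeg : ∀ {ℓ} {E : Pred (Fin r) ℓ} (E? : Decidable E) → 0# ≤ Pr E?
    Pr-nonNeg E? = ≤-trans (≤-reflexive (sym (sum-replicate-zero r)))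
                           (sum-mono (λ ω → part (does (E? ω)) (mass-nonNeg ω)))
      where
      part : ∀ b {m} → 0# ≤ m → 0# ≤ (if b then m else 0#)
      part true  0≤m = 0≤m
      part false _   = ≤-refl

  module _ {U : Set} (F : Similarity K U) {n : ℕ} (u v : U) where
    open Similarity F
    open SimilarityGraph K F (stream {n = n} u v)

    private
      -- The `n` copies of `v` include the node itself, so its self-loop is counted.
      degree-suc : ∀ {w} → f u v ≈ w → ∀ i → degree (suc i) ≈ w + fromℕ n
      degree-suc fuv≈w i = +-cong (trans (f-sym v u) fuv≈w)
        (trans (sum-const n (λ _ → f-refl v)) (*-identityʳ _))

      degree-zero : ∀ {w} → f u v ≈ w → degree zero ≈ 1# + fromℕ n * w
      degree-zero fuv≈w = +-cong (f-refl u) (sum-const n (λ _ → fuv≈w))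

    -- Node 0 is isolated and has degree 1. The others form a clique of degree `n` and together
    -- contribute n · 1/n = 1, so `DI` is 2.
    share-dissimilar : ¬ fromℕ n ≈ 0# → f u v ≈ 0# → degree zero ⁻¹ * DI ⁻¹ ≈ half
    share-dissimilar n≉0 fuv≈0 = trans (*-cong d₀⁻¹≈1 (⁻¹-cong DI≈2)) (*-identityˡ _)
      where
      d₀⁻¹≈1 : degree zero ⁻¹ ≈ 1#
      d₀⁻¹≈1 = trans (⁻¹-cong (trans (degree-zero fuv≈0) (trans (+-congˡ (zeroʳ _)) (+-identityʳ _)))) 1⁻¹≈1
      DI≈2 : DI ≈ 1# + 1#
      DI≈2 = +-cong d₀⁻¹≈1 (trans
        (sum-const n (λ i → ⁻¹-cong (trans (degree-suc fuv≈0 i) (+-identityˡ _))))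
        (⁻¹-inverseʳ n≉0))

    -- All n + 1 nodes have degree n + 1, so `DI` is 1.
    share-similar : f u v ≈ 1# → fromℕ (suc n) * (degree zero ⁻¹ * DI ⁻¹) ≈ 1#
    share-similar fuv≈1 = begin-equality
      fromℕ (suc n) * (degree zero ⁻¹ * DI ⁻¹)
        ≈⟨ *-congˡ (*-cong (⁻¹-cong d₀≈N) (trans (⁻¹-cong DI≈1) 1⁻¹≈1)) ⟩
      fromℕ (suc n) * (fromℕ (suc n) ⁻¹ * 1#)
        ≈⟨ *-congˡ (*-identityʳ _) ⟩
      fromℕ (suc n) * fromℕ (suc n) ⁻¹
        ≈⟨ N*N⁻¹≈1 ⟩
      1# ∎
      where
      N*N⁻¹≈1 : fromℕ (suc n) * fromℕ (suc n) ⁻¹ ≈ 1#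
      N*N⁻¹≈1 = ⁻¹-inverseʳ (1≤x⇒x≉0 (1≤fromℕ-suc n))
      d₀≈N : degree zero ≈ fromℕ (suc n)
      d₀≈N = trans (degree-zero fuv≈1) (+-congˡ (*-identityʳ _))
      degree≈N : ∀ i → degree i ≈ fromℕ (suc n)
      degree≈N zero    = d₀≈N
      degree≈N (suc i) = degree-suc fuv≈1 i
      DI≈1 : DI ≈ 1#
      DI≈1 = trans (sum-const (suc n) (λ i → ⁻¹-cong (degree≈N i))) N*N⁻¹≈1

  module _ {U : Set} (F : Similarity K U) {n p s : ℕ} (A : Algorithm K U (suc n) p s)
           {ε : Carrier} (ε<9/10 : ε < 9 /ℕ 10)
           (correct : IsSamplerOn K F ε (49 /ℕ 100) A) (u v : U) where

    open Similarity F
    open SimilarityGraph K F (stream {n = n} u v)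
    open Algorithm A
    open Distribution seedDist
    open IsSamplerOn correct

    private
      σ : Vector U (suc n)
      σ = stream u v

      success : Carrier
      success = Pr (∁? (outputs? σ nothing))

    -- The joint probability of success and output 0: unlike the conditional one, it is a plain sum
    -- over seeds.
    sampleProb : Carrier
    sampleProb = Pr (outputs? σ (just zero) ∩? ∁? (outputs? σ nothing))

    private
      10ε≤9 : fromℕ 10 * ε ≤ fromℕ 9
      10ε≤9 = begin
        fromℕ 10 * ε           ≤⟨ *-monoʳ-≤ (fromℕ-nonNeg 10) (proj₁ ε<9/10) ⟩
        fromℕ 10 * (9 /ℕ 10)   ≈⟨ /ℕ-inverse 9 9 ⟩
        fromℕ 9                ∎

      ε≤1 : ε ≤ 1#
      ε≤1 = *-cancelˡ-≤ (1≤fromℕ-suc 9) (begin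
        fromℕ 10 * ε  ≤⟨ 10ε≤9 ⟩
        fromℕ 9       ≤⟨ fromℕ-mono-≤ (ℕ.n≤1+n 9) ⟩
        fromℕ 10      ≈⟨ *-identityʳ _ ⟨
        fromℕ 10 * 1# ∎)

      1≤10[1-ε] : 1# ≤ fromℕ 10 * (1# - ε)
      1≤10[1-ε] = +-cancelˡ-≤ (fromℕ 9) (begin
        fromℕ 9 + 1#                            ≈⟨ +-comm _ _ ⟩
        fromℕ 10                                ≈⟨ *-identityʳ _ ⟨
        fromℕ 10 * 1#                           ≈⟨ *-congˡ 1≈ ⟩
        fromℕ 10 * (ε + (1# - ε))               ≈⟨ distribˡ _ _ _ ⟩
        fromℕ 10 * ε + fromℕ 10 * (1# - ε)      ≤⟨ +-mono-≤ 10ε≤9 ≤-refl ⟩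
        fromℕ 9 + fromℕ 10 * (1# - ε)           ∎)
        where
        1≈ : 1# ≈ ε + (1# - ε)
        1≈ = sym (trans (solve 3 (λ e o m → e :+ (o :+ m) := o :+ (e :+ m)) refl ε 1# (- ε))
                        (trans (+-congˡ (-‿inverseʳ ε)) (+-identityʳ 1#)))

      failure+success : failure σ + success ≈ 1#
      failure+success = Pr-∁ seedDist (outputs? σ nothing)

      success≤1 : success ≤ 1#
      success≤1 = begin
        success             ≤⟨ x≤x+nonNeg (Pr-nonNeg seedDist (outputs? σ nothing)) ⟩
        success + failure σ ≈⟨ +-comm _ _ ⟩
        failure σ + success ≈⟨ failure+success ⟩
        1#                  ∎

      1≤2success : 1# ≤ fromℕ 2 * success
      -- The failure bound 49/100 is relaxed to 50/100, so that 50 cancels from 100 = 50 · 2.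
      1≤2success = *-cancelˡ-≤ (1≤fromℕ-suc 49) (+-cancelˡ-≤ (fromℕ 50) (begin
        fromℕ 50 + fromℕ 50 * 1#                     ≈⟨ +-congˡ (*-identityʳ _) ⟩
        fromℕ 50 + fromℕ 50                          ≈⟨ fromℕ-+ 50 50 ⟨
        fromℕ 100                                    ≈⟨ *-identityʳ _ ⟨
        fromℕ 100 * 1#                               ≈⟨ *-congˡ failure+success ⟨
        fromℕ 100 * (failure σ + success)            ≈⟨ distribˡ _ _ _ ⟩
        fromℕ 100 * failure σ + fromℕ 100 * success  ≤⟨ +-mono-≤ 100failure≤50 ≤-refl ⟩
        fromℕ 50 + fromℕ 100 * success               ≈⟨ +-congˡ (trans (*-congʳ (fromℕ-* 50 2)) (*-assoc _ _ _)) ⟩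
        fromℕ 50 + fromℕ 50 * (fromℕ 2 * success)    ∎))
        where
        100failure≤50 : fromℕ 100 * failure σ ≤ fromℕ 50
        100failure≤50 = begin
          fromℕ 100 * failure σ     ≤⟨ *-monoʳ-≤ (fromℕ-nonNeg 100) (failure-bound σ) ⟩
          fromℕ 100 * (49 /ℕ 100)   ≈⟨ /ℕ-inverse 49 99 ⟩
          fromℕ 49                  ≤⟨ fromℕ-mono-≤ (ℕ.n≤1+n 49) ⟩
          fromℕ 50                  ∎

      0≤success : 0# ≤ success
      0≤success = Pr-nonNeg seedDist (∁? (outputs? σ nothing))

      success≉0 : ¬ success ≈ 0#
      success≉0 success≈0 = 1≰0 (≤-trans 1≤2success
        (≤-reflexive (trans (*-congˡ success≈0) (zeroʳ _))))

      sampleProb≈ : sampleProb ≈ outputProb σ zero * success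
      sampleProb≈ = sym (trans (*-assoc _ _ _)
        (trans (*-congˡ (trans (*-comm _ _) (⁻¹-inverseʳ success≉0))) (*-identityʳ _)))

    -- Given success, node 0 has probability at least (1/10)(1/2) = 1/20; success itself contributes
    -- a factor of at least 1/2.
    sampleProb-dissimilar : ¬ fromℕ n ≈ 0# → f u v ≈ 0# → 1# + 1# ≤ fromℕ 80 * sampleProb
    sampleProb-dissimilar n≉0 fuv≈0 = begin
      1# + 1#                                        ≤⟨ +-mono-≤ 1≤40P 1≤40P ⟩
      fromℕ 40 * sampleProb + fromℕ 40 * sampleProb  ≈⟨ distribʳ _ _ _ ⟨
      (fromℕ 40 + fromℕ 40) * sampleProb             ≈⟨ *-congʳ (fromℕ-+ 40 40) ⟨
      fromℕ 80 * sampleProb                          ∎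
      where
      o = outputProb σ zero
      1≤20o : 1# ≤ fromℕ 20 * o
      1≤20o = begin
        1#                                                   ≤⟨ 1≤10[1-ε] ⟩
        fromℕ 10 * (1# - ε)                                  ≈⟨ half-double _ ⟨
        half * (fromℕ 10 * (1# - ε) + fromℕ 10 * (1# - ε))
          ≈⟨ solve 3 (λ h t e → h :* (t :* e :+ t :* e) := (t :+ t) :* (e :* h)) refl half (fromℕ 10) (1# - ε) ⟩
        (fromℕ 10 + fromℕ 10) * ((1# - ε) * half)            ≈⟨ *-cong (fromℕ-+ 10 10) (*-congˡ (share-dissimilar F {n} u v n≉0 fuv≈0)) ⟨
        fromℕ 20 * ((1# - ε) * (degree zero ⁻¹ * DI ⁻¹))     ≤⟨ *-monoʳ-≤ (fromℕ-nonNeg 20) (lower-bound σ zero) ⟩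
        fromℕ 20 * o                                         ∎
      1≤40P : 1# ≤ fromℕ 40 * sampleProb
      1≤40P = begin
        1#                                   ≤⟨ 1≤2success ⟩
        fromℕ 2 * success                    ≈⟨ *-identityˡ _ ⟨
        1# * (fromℕ 2 * success)             ≤⟨ *-monoˡ-≤ (*-nonNeg (fromℕ-nonNeg 2) 0≤success) 1≤20o ⟩
        fromℕ 20 * o * (fromℕ 2 * success)
          ≈⟨ solve 4 (λ a o b s → a :* o :* (b :* s) := a :* b :* (o :* s)) refl (fromℕ 20) o (fromℕ 2) success ⟩
        fromℕ 20 * fromℕ 2 * (o * success)   ≈⟨ *-cong (fromℕ-* 20 2) sampleProb≈ ⟨
        fromℕ 40 * sampleProb                ∎

    -- Given success, node 0 has probability at most (1 + ε)/(n + 1) ≤ 2/160; joining with success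
    -- cannot increase it.
    sampleProb-similar : 160 ℕ.≤ suc n → f u v ≈ 1# → fromℕ 80 * sampleProb ≤ 1#
    sampleProb-similar 160≤N fuv≈1 = *-cancelˡ-≤ (1≤fromℕ-suc 1) (begin
      fromℕ 2 * (fromℕ 80 * sampleProb)   ≈⟨ *-assoc _ _ _ ⟨
      fromℕ 2 * fromℕ 80 * sampleProb     ≈⟨ *-congʳ (fromℕ-* 2 80) ⟨
      fromℕ 160 * sampleProb              ≤⟨ *-monoˡ-≤ (Pr-nonNeg seedDist (outputs? σ (just zero) ∩? ∁? (outputs? σ nothing))) (fromℕ-mono-≤ 160≤N) ⟩
      N * sampleProb                      ≈⟨ trans (*-congˡ sampleProb≈) (sym (*-assoc _ _ _)) ⟩
      N * outputProb σ zero * success     ≤⟨ *-monoˡ-≤ 0≤success No≤2 ⟩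
      fromℕ 2 * success                   ≤⟨ *-monoʳ-≤ (fromℕ-nonNeg 2) success≤1 ⟩
      fromℕ 2 * 1#                        ∎)
      where
      N = fromℕ (suc n)
      No≤2 : N * outputProb σ zero ≤ fromℕ 2
      No≤2 = begin
        N * outputProb σ zero                         ≤⟨ *-monoʳ-≤ (fromℕ-nonNeg (suc n)) (upper-bound σ zero) ⟩
        N * ((1# + ε) * (degree zero ⁻¹ * DI ⁻¹))
          ≈⟨ solve 3 (λ a b c → a :* (b :* c) := b :* (a :* c)) refl N (1# + ε) _ ⟩
        (1# + ε) * (N * (degree zero ⁻¹ * DI ⁻¹))     ≈⟨ trans (*-congˡ (share-similar F {n} u v fuv≈1)) (*-identityʳ _) ⟩
        1# + ε                                        ≤⟨ +-monoʳ-≤ 1# ε≤1 ⟩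
        1# + 1#                                       ≈⟨ +-congˡ (+-identityʳ 1#) ⟨
        fromℕ 2                                       ∎

-- The universe of strings and indices.

module IndexSimilarity {c ℓ₁ ℓ₂} (K : OrderedField c ℓ₁ ℓ₂) (N : ℕ) where

  open OrderedField K hiding (sum; zero)
  open OrderedFieldProperties K

  Universe : ℕ
  Universe = 2 ℕ.^ N ℕ.+ N

  string : Vec Bool N → Fin Universe
  string x = encode x ↑ˡ N

  index : Fin N → Fin Universe
  index y = 2 ℕ.^ N ↑ʳ y

  -- Defined on the disjoint union rather than on `Fin Universe`, so that symmetry and reflexivity
  -- follow by cases.
  similar : Fin (2 ℕ.^ N) ⊎ Fin N → Fin (2 ℕ.^ N) ⊎ Fin N → Bool
  similar (inj₁ a) (inj₂ y) = not (lookup (decode {N} a) y)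
  similar (inj₂ y) (inj₁ a) = not (lookup (decode {N} a) y)
  similar _        _        = true

  similar-sym : ∀ a b → similar a b ≡ similar b a
  similar-sym (inj₁ _) (inj₁ _) = ≡.refl
  similar-sym (inj₁ _) (inj₂ _) = ≡.refl
  similar-sym (inj₂ _) (inj₁ _) = ≡.refl
  similar-sym (inj₂ _) (inj₂ _) = ≡.refl

  similar-refl : ∀ a → similar a a ≡ true
  similar-refl (inj₁ _) = ≡.refl
  similar-refl (inj₂ _) = ≡.refl

  ⟦⟧-nonNeg : ∀ b → 0# ≤ ⟦ b ⟧
  ⟦⟧-nonNeg true  = 0≤1
  ⟦⟧-nonNeg false = ≤-refl

  similarity : Similarity K (Fin Universe)
  similarity = record
    { f       = λ u v → ⟦ similar (splitAt (2 ℕ.^ N) u) (splitAt (2 ℕ.^ N) v) ⟧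
    ; f-lower = λ u v → ⟦⟧-nonNeg _
    ; f-upper = λ u v → ⟦⟧≤1 _
    ; f-sym   = λ u v → reflexive (≡.cong ⟦_⟧ (similar-sym (splitAt (2 ℕ.^ N) u) (splitAt (2 ℕ.^ N) v)))
    ; f-refl  = λ u → reflexive (≡.cong ⟦_⟧ (similar-refl (splitAt (2 ℕ.^ N) u)))
    }

  open Similarity similarity

  f-string-index : ∀ x y → f (string x) (index y) ≈ ⟦ not (lookup x y) ⟧
  f-string-index x y
    rewrite Fin.splitAt-↑ˡ (2 ℕ.^ N) (encode x) N
          | Fin.splitAt-↑ʳ (2 ℕ.^ N) N y
          | decode-encode x = refl

-- The space lower bound.

<-*-contradiction : ∀ c {a b} → c ℕ.* a ℕ.< c ℕ.* b → ¬ b ℕ.≤ a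
<-*-contradiction c ca<cb b≤a = ℕ.<⇒≱ ca<cb (ℕ.*-monoʳ-≤ c b≤a)

-- The factor 1 is the constant `C` chosen in `theorem22`.
m≤m² : ∀ m → m ℕ.≤ (1 ℕ.* m) ℕ.^ 2
m≤m² zero    = ℕ.z≤n
m≤m² (suc m) = ℕ.≤-trans (ℕ.m≤n*m (suc m) 1) (ℕ.m≤m*n (1 ℕ.* suc m) (1 ℕ.* suc m ℕ.* 1))

module LowerBound {c ℓ₁ ℓ₂} (K : OrderedField c ℓ₁ ℓ₂) (p : ℕ) where

  open OrderedField K hiding (sum; zero)
  open OrderedFieldProperties K
  open IndexProblem K
  open SamplerBounds K

  -- A bit 1 gives node 0 probability at least ½ · (1/10) · ½ = 2/80, a bit 0 at most
  -- 2/n ≤ 1/80. Abstract because products with this numeral would unfold in unary.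
  abstract
    scale : ℕ
    scale = 80

    scale≡80 : scale ≡ 80
    scale≡80 = ≡.refl

  reflect-bound : ∀ l {m t} → fromℕ m ≤ (fromℕ l + fromℕ l) * (fromℕ l + fromℕ l) * fromℕ t →
                  m ℕ.≤ (l ℕ.+ l) ℕ.* (l ℕ.+ l) ℕ.* t
  reflect-bound l {m} {t} m≤ = fromℕ-cancel-≤ (begin
    fromℕ m
      ≤⟨ m≤ ⟩
    (fromℕ l + fromℕ l) * (fromℕ l + fromℕ l) * fromℕ t
      ≈⟨ *-congʳ (*-cong (fromℕ-+ l l) (fromℕ-+ l l)) ⟨
    fromℕ (l ℕ.+ l) * fromℕ (l ℕ.+ l) * fromℕ t
      ≈⟨ *-congʳ (fromℕ-* (l ℕ.+ l) (l ℕ.+ l)) ⟨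
    fromℕ ((l ℕ.+ l) ℕ.* (l ℕ.+ l)) * fromℕ t
      ≈⟨ fromℕ-* ((l ℕ.+ l) ℕ.* (l ℕ.+ l)) t ⟨
    fromℕ ((l ℕ.+ l) ℕ.* (l ℕ.+ l) ℕ.* t) ∎)

  -- The class of an index is Bob's behaviour on it, and the answer is whether Alice's simulation
  -- outputs node 0. `N` is independent of `n` and can be fixed afterwards.
  space-bound : ∀ {n ε} → 160 ℕ.≤ suc n → ε < 9 /ℕ 10 → (N : ℕ) (let open IndexSimilarity K N)
    (S : Sampler K (suc n) p ε (49 /ℕ 100)) →
    N ℕ.≤ (scale ℕ.+ scale) ℕ.* (scale ℕ.+ scale) ℕ.* behaviours p (Sampler.space S similarity)
  space-bound {n} 160≤n ε<9/10 N S =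
    reflect-bound scale (index-bound seedDist κ answer (fromℕ scale) high low)
    where
    open IndexSimilarity K N
    open Sampler S
    A = algorithm similarity
    open Algorithm A
    open TwoParty A
    T = behaviours p (space similarity)
    κ : Fin seeds → Fin N → Fin T
    κ ω y = behaviour ω (index y)
    answer : Fin seeds → Vec Bool N → Fin T → Bool
    answer ω x b = isNode zero (alice ω (string x) b)
    P : Vec Bool N → Fin N → Carrier
    P x y = sampleProb similarity A ε<9/10 (correct similarity) (string x) (index y)
    accept≈P : ∀ x y → accept seedDist κ answer x y ≈ P x y
    accept≈P x y = reflexive (sum-cong-≗ {seeds} (λ ω →
      ≡.cong (λ o → if isNode zero o then Distribution.mass seedDist ω else 0#)
             (≡.sym (run-stream ω (string x) (index y)))))
    f-bit : ∀ x y {b} → lookup x y ≡ b → Similarity.f similarity (string x) (index y) ≈ ⟦ not b ⟧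
    f-bit x y eq = trans (f-string-index x y) (reflexive (≡.cong (⟦_⟧ ∘ not) eq))
    n≉0 : ¬ fromℕ n ≈ 0#
    n≉0 = 1≤x⇒x≉0 (≤-trans (≤-reflexive (sym (+-identityʳ 1#)))
      (fromℕ-mono-≤ {1} (ℕ.≤-trans (ℕ.s≤s ℕ.z≤n) (ℕ.s≤s⁻¹ 160≤n))))
    scale*accept≈80*P : ∀ x y → fromℕ scale * accept seedDist κ answer x y ≈ fromℕ 80 * P x y
    scale*accept≈80*P x y = *-cong (reflexive (≡.cong fromℕ scale≡80)) (accept≈P x y)
    high : ∀ x y → lookup x y ≡ true → 1# + 1# ≤ fromℕ scale * accept seedDist κ answer x y
    high x y eq = ≤-trans
      (sampleProb-dissimilar similarity A ε<9/10 (correct similarity) (string x) (index y) n≉0 (f-bit x y eq))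
      (≤-reflexive (sym (scale*accept≈80*P x y)))
    low : ∀ x y → lookup x y ≡ false → fromℕ scale * accept seedDist κ answer x y ≤ 1#
    low x y eq = ≤-trans (≤-reflexive (scale*accept≈80*P x y))
      (sampleProb-similar similarity A ε<9/10 (correct similarity) (string x) (index y) 160≤n (f-bit x y eq))

  sampler-bound : ∀ n → 160 ℕ.≤ n → ∀ ε → 0# < ε → ε < 9 /ℕ 10 → (S : Sampler K n p ε (49 /ℕ 100)) →
          ∃[ m ] ∃[ F ] n ℕ.≤ (1 ℕ.* Sampler.space S {m} F) ℕ.^ 2
  sampler-bound (suc n) 160≤n ε _ ε<9/10 S = Universe , similarity , ℕ.≮⇒≥ small-space-absurd
    where
    k = (scale ℕ.+ scale) ℕ.* (scale ℕ.+ scale)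
    -- One more than `space-bound` permits for a memory of `suc n` bits; by monotonicity no smaller
    -- memory works either.
    N = suc (k ℕ.* behaviours p (suc n))
    open IndexSimilarity K N
    s = Sampler.space S similarity
    small-space-absurd : ¬ (1 ℕ.* s) ℕ.^ 2 ℕ.< suc n
    small-space-absurd s²<n =
      <-*-contradiction k (space-bound 160≤n ε<9/10 N S) (behaviours-mono p s≤n)
      where
      s≤n : s ℕ.≤ suc n
      -- The assumption s² < n is relaxed to s ≤ n, the form in which `behaviours-mono` takes it.
      s≤n = ℕ.≤-trans (m≤m² s) (ℕ.<⇒≤ s²<n)

open import Data.Nat.Base using (_*_; _^_; _≤_)

theorem22 : ∀ {c ℓ₁ ℓ₂} (K : OrderedField c ℓ₁ ℓ₂) (let module K = OrderedField K) (p : ℕ) →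
    ∃[ C ] ∃[ n₀ ] (∀ (n : ℕ) → n₀ ≤ n →
    ∀ (ε : K.Carrier) → K.0# K.< ε → ε K.< 9 K./ℕ 10 →
    (S : Sampler K n p ε (49 K./ℕ 100)) →
    ∃[ m ] ∃[ F ] n ≤ (C * Sampler.space S {m} F) ^ 2)
-- The threshold 160 is the length from which 2/n ≤ 1/80.
theorem22 K p = 1 , 160 , LowerBound.sampler-bound K p
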